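{- For any statement $s$, state $\sigma$ and resumption $r$, $(s,\sigma)\Rightarrow r$ (big-step evaluation) if and only if $(s,\sigma)\rightsquigarrow r$ (small-step evaluation).
   Context: Language. Given sets of variables $x$ and pure expressions $e$; values are integers; states $\sigma$ map variables to integers; $\sigma[x\mapsto v]$ is state update; $\llbracket e\rrbracket\sigma\in\mathbb Z$ is the value of $e$ in $\sigma$; $\sigma\models e$ means $\llbracket e\rrbracket\sigma\neq 0$. Statements: $s::=\mathsf{skip}\mid s_0;s_1\mid x:=e\mid\mathsf{if}~e~\mathsf{then}~s_t~\mathsf{else}~s_f\mid\mathsf{while}~e~\mathsf{do}~s_t\mid\mathsf{input}~x\mid\mathsf{output}~e$. Resumptions $r:\mathit{res}$ are defined coinductively by the constructors $\mathit{ret}~\sigma$, $\mathit{in}~f$ ($f:\mathbb Z\to\mathit{res}$), $\mathit{out}~v~r$ ($v\in\mathbb Z$), $\delta~r$. Strong bisimilarity $\approx$ is defined coinductively: $\mathit{ret}~\sigma\approx\mathit{ret}~\sigma$; $\mathit{in}~f\approx\mathit{in}~f_*$ if $\forall v.\,f\,v\approx f_*\,v$; $\mathit{out}~v~r\approx\mathit{out}~v~r_*$ if $r\approx r_*$; $\delta~r\approx\delta~r_*$ if $r\approx r_*$. Strongly bisimilar resumptions count as equal (resumptions form a setoid with equality $\approx$), and the rules below are read accordingly. Big-step semantics. Evaluation $(s,\sigma)\Rightarrow r$ and extended evaluation $(s,r)\stackrel{*}{\Rightarrow}r'$ are defined mutually coinductively by: $(x:=e,\sigma)\Rightarrow\delta(\mathit{ret}~\sigma[x\mapsto\llbracket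 e\rrbracket\sigma])$; $(\mathsf{skip},\sigma)\Rightarrow\mathit{ret}~\sigma$; $(s_0;s_1,\sigma)\Rightarrow r'$ if $(s_0,\sigma)\Rightarrow r$ and $(s_1,r)\stackrel{*}{\Rightarrow}r'$; $(\mathsf{if}~e~\mathsf{then}~s_t~\mathsf{else}~s_f,\sigma)\Rightarrow r$ if either $\sigma\models e$ and $(s_t,\delta(\mathit{ret}~\sigma))\stackrel{*}{\Rightarrow}r$, or $\sigma\not\models e$ and $(s_f,\delta(\mathit{ret}~\sigma))\stackrel{*}{\Rightarrow}r$; $(\mathsf{while}~e~\mathsf{do}~s_t,\sigma)\Rightarrow r'$ if $\sigma\models e$, $(s_t,\delta(\mathit{ret}~\sigma))\stackrel{*}{\Rightarrow}r$ and $(\mathsf{while}~e~\mathsf{do}~s_t,r)\stackrel{*}{\Rightarrow}r'$; $(\mathsf{while}~e~\mathsf{do}~s_t,\sigma)\Rightarrow\delta(\mathit{ret}~\sigma)$ if $\sigma\not\models e$; $(\mathsf{input}~x,\sigma)\Rightarrow\mathit{in}(\lambda v.\,\mathit{ret}~\sigma[x\mapsto v])$; $(\mathsf{output}~e,\sigma)\Rightarrow\mathit{out}~(\llbracket e\rrbracket\sigma)~(\mathit{ret}~\sigma)$; $(s,\mathit{ret}~\sigma)\stackrel{*}{\Rightarrow}r$ if $(s,\sigma)\Rightarrow r$; $(s,\mathit{in}~f)\stackrel{*}{\Rightarrow}\mathit{in}~f'$ if $\forall v.\,(s,f\,v)\stackrel{*}{\Rightarrow}f'\,v$; $(s,\mathit{out}~v~r)\stackrel{*}{\Rightarrow}\mathit{out}~v~r'$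 if $(s,r)\stackrel{*}{\Rightarrow}r'$; $(s,\delta~r)\stackrel{*}{\Rightarrow}\delta~r'$ if $(s,r)\stackrel{*}{\Rightarrow}r'$. Small-step semantics. Labelled configurations $c$ are of the forms $\underline{\mathit{ret}}~\sigma$, $\underline{\mathit{in}}~s~g$ ($g:\mathbb Z\to$ states), $\underline{\mathit{out}}~v~s~\sigma$, $\underline{\delta}~s~\sigma$. One-step reduction $(s,\sigma)\to c$ is defined inductively: $(x:=e,\sigma)\to\underline\delta~\mathsf{skip}~(\sigma[x\mapsto\llbracket e\rrbracket\sigma])$; $(\mathsf{skip},\sigma)\to\underline{\mathit{ret}}~\sigma$; $(s_0;s_1,\sigma)\to c$ if $(s_0,\sigma)\to\underline{\mathit{ret}}~\sigma'$ and $(s_1,\sigma')\to c$; $(s_0;s_1,\sigma)\to\underline{\mathit{in}}~(s_0';s_1)~g$ if $(s_0,\sigma)\to\underline{\mathit{in}}~s_0'~g$; $(s_0;s_1,\sigma)\to\underline{\mathit{out}}~v~(s_0';s_1)~\sigma'$ if $(s_0,\sigma)\to\underline{\mathit{out}}~v~s_0'~\sigma'$; $(s_0;s_1,\sigma)\to\underline\delta~(s_0';s_1)~\sigma'$ if $(s_0,\sigma)\to\underline\delta~s_0'~\sigma'$; $(\mathsf{if}~e~\mathsf{then}~s_t~\mathsf{else}~s_f,\sigma)\to\underline\delta~s_t~\sigma$ if $\sigma\models e$, and $\to\underline\delta~s_f~\sigma$ if $\sigma\not\models e$; $(\mathsf{while}~e~\mathsf{do}~s_t,\sigma)\to\underline\delta~(s_t;\mathsf{while}~e~\mathsf{do}~s_t)~\sigma$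 if $\sigma\models e$, and $\to\underline\delta~\mathsf{skip}~\sigma$ if $\sigma\not\models e$; $(\mathsf{input}~x,\sigma)\to\underline{\mathit{in}}~\mathsf{skip}~(\lambda v.\,\sigma[x\mapsto v])$; $(\mathsf{output}~e,\sigma)\to\underline{\mathit{out}}~(\llbracket e\rrbracket\sigma)~\mathsf{skip}~\sigma$. Small-step evaluation $(s,\sigma)\rightsquigarrow r$ is defined coinductively: $(s,\sigma)\rightsquigarrow\mathit{ret}~\sigma'$ if $(s,\sigma)\to\underline{\mathit{ret}}~\sigma'$; $(s,\sigma)\rightsquigarrow\delta~r$ if $(s,\sigma)\to\underline\delta~s'~\sigma'$ and $(s',\sigma')\rightsquigarrow r$; $(s,\sigma)\rightsquigarrow\mathit{in}~f$ if $(s,\sigma)\to\underline{\mathit{in}}~s'~g$ and $\forall v.\,(s',g\,v)\rightsquigarrow f\,v$; $(s,\sigma)\rightsquigarrow\mathit{out}~v~r$ if $(s,\sigma)\to\underline{\mathit{out}}~v~s'~\sigma'$ and $(s',\sigma')\rightsquigarrow r$. -}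

module Defs where

open import Level using (Level)
open import Data.Integer.Base using (ℤ; 0ℤ)
open import Data.List.Base using (List; []; _∷_)
open import Data.Maybe.Base using (Maybe; just; nothing; maybe′)
open import Data.Product.Base using (Σ-syntax; _×_; _,_)
open import Data.Unit.Base using (⊤; tt)
open import Data.Bool.Base using (if_then_else_)
open import Function.Base using (const; _∘_)
open import Relation.Binary.Definitions using (DecidableEquality)
open import Relation.Binary.PropositionalEquality.Core using (_≡_; _≢_; refl)
open import Relation.Nullary.Decidable.Core using (does)
open import Relation.Nullary.Negation.Core using (¬_)

-- Coinduction is encoded, so that --guardedness is not needed.  A coinductively
-- defined relation is the greatest fixed point of the operator given by its
-- rules, defined à la Knaster–Tarski as the union of all relations that are
-- backward closed under the rules.  Every premise that refers to the relation
-- being defined is therefore coinductive.  Restricting the union to Set-valued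
-- relations loses nothing, since each rule has at most ℤ-many premises.

record Language : Set₁ where
  field
    Var  : Set
    _≟_  : DecidableEquality Var
    Expr : Set
    ⟦_⟧_ : Expr → (Var → ℤ) → ℤ

module Semantics (L : Language) where
  open Language L

  State : Set
  State = Var → ℤ

  infixl 9 _[_↦_]
  _[_↦_] : State → Var → ℤ → State
  (σ [ x ↦ v ]) y = if does (x ≟ y) then v else σ y

  infix 4 _⊨_ _⊭_
  _⊨_ : State → Expr → Set
  σ ⊨ e = (⟦ e ⟧ σ) ≢ 0ℤ

  _⊭_ : State → Expr → Set
  σ ⊭ e = ¬ (σ ⊨ e)

  infixr 5 _⨾_
  infix  6 _≔_
  data Stmt : Set where
    skip   : Stmt
    _⨾_    : (s₀ s₁ : Stmt) → Stmt
    _≔_    : (x : Var) (e : Expr) → Stmt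
    ifte   : (e : Expr) (sᵗ sᶠ : Stmt) → Stmt
    while  : (e : Expr) (sᵗ : Stmt) → Stmt
    input  : (x : Var) → Stmt
    output : (e : Expr) → Stmt

  private
    variable
      ℓ   : Level
      X Y : Set

  -- Resumptions are the final coalgebra of ResF, with bisimilarity as equality.
  data ResF (X : Set) : Set where
    retF : State → ResF X
    inpF : (ℤ → X) → ResF X
    outF : ℤ → X → ResF X
    δF   : X → ResF X

  mapF : (X → Y) → ResF X → ResF Y
  mapF h (retF σ)   = retF σ
  mapF h (inpF f)   = inpF (h ∘ f)
  mapF h (outF v x) = outF v (h x)
  mapF h (δF x)     = δF (h x)

  -- An edge of a resumption tree: `reply v` leads from an input node to its
  -- v-th subtree, `next` from an output or delay node to its only subtree.
  data Step : Set where
    next  : Step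
    reply : ℤ → Step

  -- A possibly infinite tree, given by the constructor found at the end of
  -- each path from the root.  The value of `node` on a sequence of steps that
  -- is not a path of the tree is arbitrary, and is never inspected by `force`
  -- or _≈_.
  record Res : Set where
    constructor tree
    field
      node : List Step → ResF ⊤
  open Res public

  subtree : Res → Step → Res
  subtree r p = tree (λ ps → node r (p ∷ ps))

  attach : ResF ⊤ → (Step → X) → ResF X
  attach (retF σ)   k = retF σ
  attach (inpF _)   k = inpF (k ∘ reply)
  attach (outF v _) k = outF v (k next)
  attach (δF _)     k = δF (k next)

  force : Res → ResF Res
  force r = attach (node r []) (subtree r)

  follow : ResF X → Step → Maybe X
  follow (inpF f)   (reply v) = just (f v)
  follow (outF v x) next      = just x
  follow (δF x)     next      = just x
  follow _          _         = nothing

  con : ResF Res → Res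
  node (con t) []       = mapF (const tt) t
  node (con t) (p ∷ ps) = maybe′ (λ r → node r ps) (δF tt) (follow t p)

  ret : State → Res
  ret σ = con (retF σ)

  inp : (ℤ → Res) → Res
  inp f = con (inpF f)

  out : ℤ → Res → Res
  out v r = con (outF v r)

  δ : Res → Res
  δ r = con (δF r)

  data Lift (R : X → Y → Set ℓ) : ResF X → ResF Y → Set ℓ where
    retL : ∀ {σ} → Lift R (retF σ) (retF σ)
    inpL : ∀ {f f*} → (∀ v → R (f v) (f* v)) → Lift R (inpF f) (inpF f*)
    outL : ∀ {v r r*} → R r r* → Lift R (outF v r) (outF v r*)
    δL   : ∀ {r r*} → R r r* → Lift R (δF r) (δF r*)

  IsBisimulation : (Res → Res → Set) → Set
  IsBisimulation R = ∀ {r r*} → R r r* → Lift R (force r) (force r*)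

  infix 4 _≈_
  _≈_ : Res → Res → Set₁
  r ≈ r* = Σ[ R ∈ (Res → Res → Set) ] (IsBisimulation R × R r r*)

  force-con : (t : ResF Res) → force (con t) ≡ t
  force-con (retF σ)   = refl
  force-con (inpF f)   = refl
  force-con (outF v r) = refl
  force-con (δF r)     = refl

  -- Corecursion: every ResF-coalgebra has a coalgebra morphism into Res.
  -- Uniqueness of this morphism up to _≈_ holds because _≈_ is the largest
  -- bisimulation.
  unfold : (X → ResF X) → X → Res
  unfold {X} c x = tree (go x)
    where
    go : X → List Step → ResF ⊤
    go x []       = mapF (const tt) (c x)
    go x (p ∷ ps) = maybe′ (λ y → go y ps) (δF tt) (follow (c x) p)

  unfold-force : (c : X → ResF X) (x : X) →
                 Lift _≡_ (force (unfold c x)) (mapF (unfold c) (c x))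
  unfold-force c x with c x
  ... | retF σ   = retL
  ... | inpF f   = inpL (λ v → refl)
  ... | outF v y = outL refl
  ... | δF y     = δL refl

  private
    variable
      x        : Var
      e        : Expr
      s s₀ s₁ sᵗ sᶠ s′ s₀′ : Stmt
      σ σ′     : State
      v        : ℤ
      r r′ q q′ : Res
      f f′     : ℤ → Res
      g        : ℤ → State

  -- Reading the evaluation rules on resumptions modulo _≈_: a rule whose
  -- conclusion mentions a resumption built by a constructor applies to every
  -- resumption that is bisimilar to it.
  module BigStepRules (_⇒_  : Stmt × State → Res → Set)
                      (_⇒*_ : Stmt × Res → Res → Set) where

    data Exec : Stmt × State → Res → Set₁ where
      assign      : r ≈ δ (ret (σ [ x ↦ ⟦ e ⟧ σ ])) → Exec (x ≔ e , σ) r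
      skip        : r ≈ ret σ → Exec (skip , σ) r
      seq         : (s₀ , σ) ⇒ r → (s₁ , r) ⇒* r′ → Exec (s₀ ⨾ s₁ , σ) r′
      if-true     : σ ⊨ e → (sᵗ , δ (ret σ)) ⇒* r → Exec (ifte e sᵗ sᶠ , σ) r
      if-false    : σ ⊭ e → (sᶠ , δ (ret σ)) ⇒* r → Exec (ifte e sᵗ sᶠ , σ) r
      while-true  : σ ⊨ e → (sᵗ , δ (ret σ)) ⇒* r → (while e sᵗ , r) ⇒* r′ →
                    Exec (while e sᵗ , σ) r′
      while-false : σ ⊭ e → r ≈ δ (ret σ) → Exec (while e sᵗ , σ) r
      input       : r ≈ inp (λ v → ret (σ [ x ↦ v ])) → Exec (input x , σ) r
      output      : r ≈ out (⟦ e ⟧ σ) (ret σ) → Exec (output e , σ) r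

    data Exec* : Stmt × Res → Res → Set₁ where
      ret* : q ≈ ret σ → (s , σ) ⇒ r → Exec* (s , q) r
      inp* : q ≈ inp f → q′ ≈ inp f′ → (∀ v → (s , f v) ⇒* f′ v) →
            Exec* (s , q) q′
      out* : q ≈ out v r → q′ ≈ out v r′ → (s , r) ⇒* r′ → Exec* (s , q) q′
      δ*   : q ≈ δ r → q′ ≈ δ r′ → (s , r) ⇒* r′ → Exec* (s , q) q′

  record BigStepClosed (R  : Stmt × State → Res → Set)
                       (R* : Stmt × Res → Res → Set) : Set₁ where
    open BigStepRules R R*
    field
      exec  : ∀ {c r} → R c r → Exec c r
      exec* : ∀ {c r} → R* c r → Exec* c r

  infix 4 _⇒_ _⇒*_
  _⇒_ : Stmt × State → Res → Set₁
  c ⇒ r = Σ[ R ∈ (Stmt × State → Res → Set) ] Σ[ R* ∈ (Stmt × Res → Res → Set) ]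
          (BigStepClosed R R* × R c r)

  _⇒*_ : Stmt × Res → Res → Set₁
  c ⇒* r = Σ[ R ∈ (Stmt × State → Res → Set) ] Σ[ R* ∈ (Stmt × Res → Res → Set) ]
           (BigStepClosed R R* × R* c r)

  data Config : Set where
    retᶜ : State → Config
    inpᶜ : Stmt → (ℤ → State) → Config
    outᶜ : ℤ → Stmt → State → Config
    δᶜ   : Stmt → State → Config

  infix 4 _⟶_
  data _⟶_ : Stmt × State → Config → Set where
    assign      : (x ≔ e , σ) ⟶ δᶜ skip (σ [ x ↦ ⟦ e ⟧ σ ])
    skip        : (skip , σ) ⟶ retᶜ σ
    seq-ret     : ∀ {c} → (s₀ , σ) ⟶ retᶜ σ′ → (s₁ , σ′) ⟶ c → (s₀ ⨾ s₁ , σ) ⟶ c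
    seq-inp     : (s₀ , σ) ⟶ inpᶜ s₀′ g → (s₀ ⨾ s₁ , σ) ⟶ inpᶜ (s₀′ ⨾ s₁) g
    seq-out     : (s₀ , σ) ⟶ outᶜ v s₀′ σ′ → (s₀ ⨾ s₁ , σ) ⟶ outᶜ v (s₀′ ⨾ s₁) σ′
    seq-δ       : (s₀ , σ) ⟶ δᶜ s₀′ σ′ → (s₀ ⨾ s₁ , σ) ⟶ δᶜ (s₀′ ⨾ s₁) σ′
    if-true     : σ ⊨ e → (ifte e sᵗ sᶠ , σ) ⟶ δᶜ sᵗ σ
    if-false    : σ ⊭ e → (ifte e sᵗ sᶠ , σ) ⟶ δᶜ sᶠ σ
    while-true  : σ ⊨ e → (while e sᵗ , σ) ⟶ δᶜ (sᵗ ⨾ while e sᵗ) σ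
    while-false : σ ⊭ e → (while e sᵗ , σ) ⟶ δᶜ skip σ
    input       : (input x , σ) ⟶ inpᶜ skip (λ v → σ [ x ↦ v ])
    output      : (output e , σ) ⟶ outᶜ (⟦ e ⟧ σ) skip σ

  module SmallStepRules (_⇝_ : Stmt × State → Res → Set) where

    data Eval : Stmt × State → Res → Set₁ where
      retᵉ : (s , σ) ⟶ retᶜ σ′ → r ≈ ret σ′ → Eval (s , σ) r
      δᵉ   : (s , σ) ⟶ δᶜ s′ σ′ → (s′ , σ′) ⇝ r → q ≈ δ r → Eval (s , σ) q
      inpᵉ : (s , σ) ⟶ inpᶜ s′ g → (∀ v → (s′ , g v) ⇝ f v) → q ≈ inp f →
            Eval (s , σ) q
      outᵉ : (s , σ) ⟶ outᶜ v s′ σ′ → (s′ , σ′) ⇝ r → q ≈ out v r →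
            Eval (s , σ) q

  SmallStepClosed : (Stmt × State → Res → Set) → Set₁
  SmallStepClosed R = ∀ {c r} → R c r → SmallStepRules.Eval R c r

  infix 4 _⇝_
  _⇝_ : Stmt × State → Res → Set₁
  c ⇝ r = Σ[ R ∈ (Stmt × State → Res → Set) ] (SmallStepClosed R × R c r)

{-# OPTIONS --safe #-}

-- Since ⟶ is deterministic and total, iterating it gives a function eval with
-- c ⇝ r exactly when r ≈ eval c.  Small-step implies big-step because the pairs
-- (c , eval c) are closed under the big-step rules when (s , q) ⇒* r is read as
-- "q and r are the values of s₀ and s₀ ⨾ s in one and the same state, for some
-- s₀".  Conversely, let _⇒_ be extended by relating s₀ ⨾ s₁ in σ to r′
-- whenever s₀ in σ is already related to some r with (s₁ , r) ⇒* r′.  The result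
-- is closed under the small-step rules, by induction on the statement.
module Submission where

open import Data.Integer.Base using (ℤ; 0ℤ)
import Data.Integer.Properties as ℤ
open import Data.Nat.Base using (ℕ; zero; suc)
open import Data.Product.Base using (Σ-syntax; ∃; ∃₂; _×_; _,_; proj₁; proj₂)
open import Data.Unit.Base using (⊤)
open import Function.Base using (_∘_)
open import Function.Bundles using (_⇔_; mk⇔)
open import Level using (Level)
open import Relation.Binary.PropositionalEquality
  using (_≡_; refl; sym; subst)
open import Relation.Nullary using (Dec; yes; no; ¬?; contradiction)
open import Defs

module _ (L : Language) where
  open Language L using (Expr; ⟦_⟧_)
  open Semantics L
  open BigStepRules
  open SmallStepRules

  private
    variable
      ℓ ℓ′ ℓ″ : Level
      X Y Z : Set
      t u : ResF X
      s s₀ s₁ : Stmt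
      σ σ′ : State
      c c′ : Stmt × State
      k : Config
      q r r′ r* : Res
      f f* : ℤ → Res
      v : ℤ

  -- Relation lifting and bisimilarity

  Lift-map : {P : X → Y → Set ℓ} {Q : X → Y → Set ℓ′} →
             (∀ {x y} → P x y → Q x y) → ∀ {t u} → Lift P t u → Lift Q t u
  Lift-map h retL     = retL
  Lift-map h (inpL p) = inpL (h ∘ p)
  Lift-map h (outL p) = outL (h p)
  Lift-map h (δL p)   = δL (h p)

  Lift-refl : {P : X → X → Set ℓ} → (∀ {x} → P x x) → ∀ t → Lift P t t
  Lift-refl h (retF σ)   = retL
  Lift-refl h (inpF f)   = inpL (λ _ → h)
  Lift-refl h (outF v x) = outL h
  Lift-refl h (δF x)     = δL h

  Lift-sym : {P : X → Y → Set ℓ} {Q : Y → X → Set ℓ′} →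
             (∀ {x y} → P x y → Q y x) → ∀ {t u} → Lift P t u → Lift Q u t
  Lift-sym h retL     = retL
  Lift-sym h (inpL p) = inpL (h ∘ p)
  Lift-sym h (outL p) = outL (h p)
  Lift-sym h (δL p)   = δL (h p)

  Lift-trans : {P : X → Y → Set ℓ} {Q : Y → Z → Set ℓ′} {O : X → Z → Set ℓ″} →
               (∀ {x y z} → P x y → Q y z → O x z) →
               ∀ {t u w} → Lift P t u → Lift Q u w → Lift O t w
  Lift-trans h retL     retL      = retL
  Lift-trans h (inpL p) (inpL p′) = inpL (λ v → h (p v) (p′ v))
  Lift-trans h (outL p) (outL p′) = outL (h p p′)
  Lift-trans h (δL p)   (δL p′)   = δL (h p p′)

  -- Bisimilarity as agreement to every finite depth.  Unlike _≈_ it lives in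
  -- Set, so the witnessing relations of _⇒_ and _⇝_ may mention it.
  Agree : ℕ → Res → Res → Set
  Agree zero    r r* = ⊤
  Agree (suc n) r r* = Lift (Agree n) (force r) (force r*)

  infix 4 _∼_
  record _∼_ (r r* : Res) : Set where
    constructor to-depth
    field
      depth : ∀ n → Agree n r r*
  open _∼_

  Agree-refl : ∀ n {r} → Agree n r r
  Agree-refl zero        = _
  Agree-refl (suc n) {r} = Lift-refl (λ {x} → Agree-refl n {x}) (force r)

  Agree-sym : ∀ n {r r*} → Agree n r r* → Agree n r* r
  Agree-sym zero    _ = _
  Agree-sym (suc n) p = Lift-sym (Agree-sym n) p

  Agree-trans : ∀ n {r r′ r*} → Agree n r r′ → Agree n r′ r* → Agree n r r*
  Agree-trans zero    _ _  = _
  Agree-trans (suc n) p p′ = Lift-trans (Agree-trans n) p p′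

  ∼-refl : r ∼ r
  ∼-refl = to-depth λ n → Agree-refl n

  ∼-sym : r ∼ r* → r* ∼ r
  ∼-sym p = to-depth λ n → Agree-sym n (depth p n)

  infixr 4 _∙_
  _∙_ : r ∼ r′ → r′ ∼ r* → r ∼ r*
  p ∙ p′ = to-depth λ n → Agree-trans n (depth p n) (depth p′ n)

  ∼-fold : Lift _∼_ (force r) (force r*) → r ∼ r*
  ∼-fold {r} {r*} p = to-depth agree
    where
    agree : ∀ n → Agree n r r*
    agree zero    = _
    agree (suc n) = Lift-map (λ q → depth q n) p

  -- Agreement to depth 1 fixes the root constructor, which is then the same at every depth, so the
  -- quantifier over depths moves inside it, branch by branch.
  ∼-unfold : r ∼ r* → Lift _∼_ (force r) (force r*)
  ∼-unfold p = limit (depth p 1) (depth p ∘ suc)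
    where
    limit : Lift (Agree 0) t u → (∀ n → Lift (Agree n) t u) → Lift _∼_ t u
    limit retL     h = retL
    limit (inpL _) h = inpL λ v → to-depth λ n → case-inp (h n) v
      where
      case-inp : ∀ {n} → Lift (Agree n) (inpF f) (inpF f*) →
                 ∀ v → Agree n (f v) (f* v)
      case-inp (inpL p) = p
    limit (outL _) h = outL (to-depth λ n → case-out (h n))
      where
      case-out : ∀ {n} → Lift (Agree n) (outF v r) (outF v r*) → Agree n r r*
      case-out (outL p) = p
    limit (δL _)   h = δL (to-depth λ n → case-δ (h n))
      where
      case-δ : ∀ {n} → Lift (Agree n) (δF r) (δF r*) → Agree n r r*
      case-δ (δL p) = p

  ∼⇒≈ : r ∼ r* → r ≈ r*
  ∼⇒≈ p = _∼_ , ∼-unfold , p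

  ≈⇒∼ : r ≈ r* → r ∼ r*
  ≈⇒∼ (R , bisim , p) = to-depth λ n → agree n p
    where
    agree : ∀ n {r r*} → R r r* → Agree n r r*
    agree zero    p = _
    agree (suc n) p = Lift-map (agree n) (bisim p)

  -- Determinism and totality of the one-step reduction

  test : (e : Expr) (σ : State) → Dec (σ ⊨ e)
  test e σ = ¬? ((⟦ e ⟧ σ) ℤ.≟ 0ℤ)

  progress : ∀ s σ → ∃ λ k → (s , σ) ⟶ k
  progress skip       σ = _ , skip
  progress (s₀ ⨾ s₁)  σ with progress s₀ σ
  ... | retᶜ σ′     , d = _ , seq-ret d (proj₂ (progress s₁ σ′))
  ... | inpᶜ s′ g   , d = _ , seq-inp d
  ... | outᶜ v s′ σ′ , d = _ , seq-out d
  ... | δᶜ s′ σ′    , d = _ , seq-δ d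
  progress (x ≔ e)    σ = _ , assign
  progress (ifte e sᵗ sᶠ) σ with test e σ
  ... | yes σ⊨e = _ , if-true σ⊨e
  ... | no  σ⊭e = _ , if-false σ⊭e
  progress (while e sᵗ) σ with test e σ
  ... | yes σ⊨e = _ , while-true σ⊨e
  ... | no  σ⊭e = _ , while-false σ⊭e
  progress (input x)  σ = _ , input
  progress (output e) σ = _ , output

  step : Stmt × State → Config
  step (s , σ) = proj₁ (progress s σ)

  -- Every derivation is compared with the one that `progress` computes, so two arbitrary
  -- derivations never have to be matched against each other.
  step-unique : c ⟶ k → step c ≡ k
  step-unique assign = refl
  step-unique skip   = refl
  step-unique (seq-ret {s₀ = s₀} {σ = σ} d d′)
    with progress s₀ σ | step-unique d
  ... | _ | refl = step-unique d′
  step-unique (seq-inp {s₀ = s₀} {σ = σ} d) with progress s₀ σ | step-unique d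
  ... | _ | refl = refl
  step-unique (seq-out {s₀ = s₀} {σ = σ} d) with progress s₀ σ | step-unique d
  ... | _ | refl = refl
  step-unique (seq-δ {s₀ = s₀} {σ = σ} d) with progress s₀ σ | step-unique d
  ... | _ | refl = refl
  step-unique (if-true {σ = σ} {e = e} σ⊨e) with test e σ
  ... | yes _   = refl
  ... | no  σ⊭e = contradiction σ⊨e σ⊭e
  step-unique (if-false {σ = σ} {e = e} σ⊭e) with test e σ
  ... | yes σ⊨e = contradiction σ⊨e σ⊭e
  ... | no  _   = refl
  step-unique (while-true {σ = σ} {e = e} σ⊨e) with test e σ
  ... | yes _   = refl
  ... | no  σ⊭e = contradiction σ⊨e σ⊭e
  step-unique (while-false {σ = σ} {e = e} σ⊭e) with test e σ
  ... | yes σ⊨e = contradiction σ⊨e σ⊭e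
  ... | no  _   = refl
  step-unique input  = refl
  step-unique output = refl

  -- Small-step evaluation as a function

  successors : Config → ResF (Stmt × State)
  successors (retᶜ σ)     = retF σ
  successors (inpᶜ s g)   = inpF (λ v → s , g v)
  successors (outᶜ v s σ) = outF v (s , σ)
  successors (δᶜ s σ)     = δF (s , σ)

  eval : Stmt × State → Res
  eval = unfold (successors ∘ step)

  resume : Config → Res
  resume k = con (mapF eval (successors k))

  eval-step : ∀ c → eval c ∼ resume (step c)
  eval-step c = ∼-fold
    (subst (Lift _∼_ (force (eval c))) (sym (force-con _))
      (Lift-map (λ { refl → ∼-refl }) (unfold-force (successors ∘ step) c)))

  eval-⟶ : c ⟶ k → eval c ∼ resume k
  eval-⟶ {c} d = subst (λ k → eval c ∼ resume k) (step-unique d) (eval-step c)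

  -- Transferring transitions one way is enough: `c` has some transition by totality, and by
  -- determinism it fixes both values.
  eval-cong : (∀ {k} → c ⟶ k → c′ ⟶ k) → eval c ∼ eval c′
  eval-cong {s , σ} h with progress s σ
  ... | _ , d = eval-⟶ d ∙ ∼-sym (eval-⟶ (h d))

  eval-skip⨾ : eval (skip ⨾ s , σ) ∼ eval (s , σ)
  eval-skip⨾ = ∼-sym (eval-cong (seq-ret skip))

  δ-cong : r ∼ r* → δ r ∼ δ r*
  δ-cong p = ∼-fold (δL p)

  out-cong : r ∼ r* → out v r ∼ out v r*
  out-cong p = ∼-fold (outL p)

  inp-cong : (∀ v → f v ∼ f* v) → inp f ∼ inp f*
  inp-cong p = ∼-fold (inpL p)

  -- From small-step to big-step

  module _ {T : Stmt × State → Res → Set} (closed : SmallStepClosed T) where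

    -- Induction on the depth replaces coinduction: each use of `closed` exposes one constructor and
    -- leaves pairs that lie again in `T`.
    ⇝-unique : T c r → r ∼ eval c
    ⇝-unique p = to-depth λ n → agree n p
      where
      agree : ∀ n {c r} → T c r → Agree n r (eval c)

      agree-⟶ : ∀ n → c ⟶ k → q ≈ r → Agree n r (resume k) → Agree n q (eval c)
      agree-⟶ n d eq p =
        Agree-trans n (depth (≈⇒∼ eq) n)
          (Agree-trans n p (depth (∼-sym (eval-⟶ d)) n))

      agree zero    p = _
      agree (suc n) p with closed p
      ... | retᵉ d eq    = agree-⟶ (suc n) d eq retL
      ... | δᵉ d p′ eq   = agree-⟶ (suc n) d eq (δL (agree n p′))
      ... | inpᵉ d p′ eq = agree-⟶ (suc n) d eq (inpL (agree n ∘ p′))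
      ... | outᵉ d p′ eq = agree-⟶ (suc n) d eq (outL (agree n p′))

  Evals : Stmt × State → Res → Set
  Evals c r = r ∼ eval c

  Evals* : Stmt × Res → Res → Set
  Evals* (s , q) r = ∃₂ λ s₀ σ → q ∼ eval (s₀ , σ) × r ∼ eval (s₀ ⨾ s , σ)

  -- A statement whose value is δ (ret σ), the argument of _⇒*_ in the rules
  -- for conditionals and loops.
  tick : Expr → Stmt
  tick e = ifte e skip skip

  tick-⟶ : ∀ e σ → (tick e , σ) ⟶ δᶜ skip σ
  tick-⟶ e σ with test e σ
  ... | yes σ⊨e = if-true σ⊨e
  ... | no  σ⊭e = if-false σ⊭e

  eval-skip : eval (skip , σ) ∼ ret σ
  eval-skip = eval-⟶ skip

  eval-tick : ∀ e σ → eval (tick e , σ) ∼ δ (ret σ)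
  eval-tick e σ = eval-⟶ (tick-⟶ e σ) ∙ δ-cong eval-skip

  eval-tick⨾ : ∀ e → eval (tick e ⨾ s , σ) ∼ δ (eval (s , σ))
  eval-tick⨾ e = eval-⟶ (seq-δ (tick-⟶ e _)) ∙ δ-cong eval-skip⨾

  Evals-closed : BigStepClosed Evals Evals*
  Evals-closed = record { exec = exec _ ; exec* = exec* }
    where
    exec : ∀ c {r} → Evals c r → Exec Evals Evals* c r
    exec (skip , σ) p = skip (∼⇒≈ (p ∙ eval-skip))
    exec (s₀ ⨾ s₁ , σ) p = seq ∼-refl (s₀ , σ , ∼-refl , p)
    exec (x ≔ e , σ) p = assign (∼⇒≈ (p ∙ eval-⟶ assign ∙ δ-cong eval-skip))
    exec (ifte e sᵗ sᶠ , σ) p with test e σ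
    ... | yes σ⊨e = if-true σ⊨e
      (tick e , σ , ∼-sym (eval-tick e σ) ,
        (p ∙ eval-⟶ (if-true σ⊨e) ∙ ∼-sym (eval-tick⨾ e)))
    ... | no σ⊭e = if-false σ⊭e
      (tick e , σ , ∼-sym (eval-tick e σ) ,
        (p ∙ eval-⟶ (if-false σ⊭e) ∙ ∼-sym (eval-tick⨾ e)))
    exec (while e sᵗ , σ) p with test e σ
    ... | yes σ⊨e = while-true σ⊨e
      (tick e , σ , ∼-sym (eval-tick e σ) , ∼-refl)
      -- The intermediate resumption is the value of `tick e ⨾ sᵗ`. Followed by the loop, this
      -- statement takes one delay to `(skip ⨾ sᵗ) ⨾ while e sᵗ`, which can make every step of
      -- `sᵗ ⨾ while e sᵗ`.
      (tick e ⨾ sᵗ , σ , ∼-refl ,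
        (p ∙ eval-⟶ (while-true σ⊨e) ∙
         δ-cong (eval-cong skip⨾-⨾) ∙
         ∼-sym (eval-⟶ (seq-δ (seq-δ (tick-⟶ e σ))))))
      where
      skip⨾-⨾ : (s₀ ⨾ s₁ , σ) ⟶ k → ((skip ⨾ s₀) ⨾ s₁ , σ) ⟶ k
      skip⨾-⨾ (seq-ret d d′) = seq-ret (seq-ret skip d) d′
      skip⨾-⨾ (seq-inp d)    = seq-inp (seq-ret skip d)
      skip⨾-⨾ (seq-out d)    = seq-out (seq-ret skip d)
      skip⨾-⨾ (seq-δ d)      = seq-δ (seq-ret skip d)
    ... | no σ⊭e = while-false σ⊭e
      (∼⇒≈ (p ∙ eval-⟶ (while-false σ⊭e) ∙ δ-cong eval-skip))
    exec (input x , σ) p =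
      input (∼⇒≈ (p ∙ eval-⟶ input ∙ inp-cong (λ v → eval-skip)))
    exec (output e , σ) p =
      output (∼⇒≈ (p ∙ eval-⟶ output ∙ out-cong eval-skip))

    exec* : ∀ {c r} → Evals* c r → Exec* Evals Evals* c r
    -- The first step of `s₀` fixes the root of the argument and so selects the rule; what remains
    -- of `s₀` is the next witness.
    exec* (s₀ , σ , p , p′) with progress s₀ σ
    ... | retᶜ σ′ , d =
      ret* (∼⇒≈ (p ∙ eval-⟶ d)) (p′ ∙ ∼-sym (eval-cong (seq-ret d)))
    ... | inpᶜ s₀′ g , d =
      inp* (∼⇒≈ (p ∙ eval-⟶ d)) (∼⇒≈ (p′ ∙ eval-⟶ (seq-inp d)))
        (λ v → s₀′ , g v , ∼-refl , ∼-refl)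
    ... | outᶜ v s₀′ σ′ , d =
      out* (∼⇒≈ (p ∙ eval-⟶ d)) (∼⇒≈ (p′ ∙ eval-⟶ (seq-out d)))
        (s₀′ , σ′ , ∼-refl , ∼-refl)
    ... | δᶜ s₀′ σ′ , d =
      δ* (∼⇒≈ (p ∙ eval-⟶ d)) (∼⇒≈ (p′ ∙ eval-⟶ (seq-δ d)))
        (s₀′ , σ′ , ∼-refl , ∼-refl)

  -- From big-step to small-step

  module _ {R : Stmt × State → Res → Set} {R* : Stmt × Res → Res → Set}
           (closed : BigStepClosed R R*) where
    open BigStepClosed closed

    -- Inversion of `R*` along the root constructor of its argument. An arbitrary closed `R*` need
    -- not respect `∼`, so the subtrees are related to it only up to `∼`.
    data Ext (s : Stmt) : ResF Res → Res → Set₁ where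
      retX : R (s , σ) r → Ext s (retF σ) r
      inpX : ∀ {y y′ : ℤ → Res} → (∀ v → f v ∼ y v) →
             (∀ v → R* (s , y v) (y′ v)) →
             r ≈ inp y′ → Ext s (inpF f) r
      outX : ∀ {x y y′} → x ∼ y → R* (s , y) y′ → r ≈ out v y′ →
             Ext s (outF v x) r
      δX   : ∀ {x y y′} → x ∼ y → R* (s , y) y′ → r ≈ δ y′ → Ext s (δF x) r

    ext : R* (s , q) r → q ∼ r* → Ext s (force r*) r
    ext p q∼r* with exec* p
    -- `case` generalises `force r*` to a variable, so that matching on the `Lift` can refine it.
    ... | ret* eq p′     = case (∼-unfold (∼-sym q∼r* ∙ ≈⇒∼ eq))
      where
      case : Lift _∼_ t (retF _) → Ext _ t _
      case retL = retX p′
    ... | inp* eq eq′ p′ = case (∼-unfold (∼-sym q∼r* ∙ ≈⇒∼ eq))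
      where
      case : Lift _∼_ t (inpF _) → Ext _ t _
      case (inpL h) = inpX h p′ eq′
    ... | out* eq eq′ p′ = case (∼-unfold (∼-sym q∼r* ∙ ≈⇒∼ eq))
      where
      case : Lift _∼_ t (outF _ _) → Ext _ t _
      case (outL h) = outX h p′ eq′
    ... | δ* eq eq′ p′   = case (∼-unfold (∼-sym q∼r* ∙ ≈⇒∼ eq))
      where
      case : Lift _∼_ t (δF _) → Ext _ t _
      case (δL h) = δX h p′ eq′

    ext-δ-ret : R* (s , δ (ret σ)) r → Σ[ r′ ∈ Res ] R (s , σ) r′ × r ≈ δ r′
    ext-δ-ret p with ext p ∼-refl
    ... | δX h p′ eq with ext p′ (∼-sym h)
    ... | retX p″ = _ , p″ , eq

    -- `skip` covers what assignments, input, output and loop exits reduce to, since `R` need not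
    -- contain such pairs. The slack `r ∼ q` absorbs the bisimilarities produced by `Ext`.
    data Seqs : Stmt × State → Res → Set where
      big  : R (s , σ) r → Seqs (s , σ) r
      skip : r ∼ ret σ → Seqs (skip , σ) r
      seq  : Seqs (s₀ , σ) r → r ∼ q → R* (s₁ , q) r′ → Seqs (s₀ ⨾ s₁ , σ) r′

    Eval-cong : (∀ {k} → c ⟶ k → c′ ⟶ k) → Eval Seqs c r → Eval Seqs c′ r
    Eval-cong h (retᵉ d eq)   = retᵉ (h d) eq
    Eval-cong h (δᵉ d p eq)   = δᵉ (h d) p eq
    Eval-cong h (inpᵉ d p eq) = inpᵉ (h d) p eq
    Eval-cong h (outᵉ d p eq) = outᵉ (h d) p eq

    -- The first step of `s₀` decides. If `s₀` returns, `s₁` must step at once, which is what the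
    -- hypothesis on `R` provides; otherwise the rest is again a `seq`.
    Eval-seq : (∀ {σ r} → R (s₁ , σ) r → Eval Seqs (s₁ , σ) r) →
               Eval Seqs (s₀ , σ) r → r ∼ q → R* (s₁ , q) r′ →
               Eval Seqs (s₀ ⨾ s₁ , σ) r′
    Eval-seq h (retᵉ d eq) r∼q p with ext p (∼-sym r∼q ∙ ≈⇒∼ eq)
    ... | retX p₁ = Eval-cong (seq-ret d) (h p₁)
    Eval-seq h (δᵉ d p₀ eq) r∼q p with ext p (∼-sym r∼q ∙ ≈⇒∼ eq)
    ... | δX x∼y p₁ eq′ = δᵉ (seq-δ d) (seq p₀ x∼y p₁) eq′
    Eval-seq h (inpᵉ d p₀ eq) r∼q p with ext p (∼-sym r∼q ∙ ≈⇒∼ eq)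
    ... | inpX x∼y p₁ eq′ =
      inpᵉ (seq-inp d) (λ v → seq (p₀ v) (x∼y v) (p₁ v)) eq′
    Eval-seq h (outᵉ d p₀ eq) r∼q p with ext p (∼-sym r∼q ∙ ≈⇒∼ eq)
    ... | outX x∼y p₁ eq′ = outᵉ (seq-out d) (seq p₀ x∼y p₁) eq′

    -- Recursion enters only the components of a sequence, which may step immediately. Branches and
    -- loop bodies sit behind a delay, where membership in `Seqs` suffices, so a loop is never
    -- unfolded recursively.
    big-Eval : ∀ s {σ r} → R (s , σ) r → Eval Seqs (s , σ) r
    big-Eval s p with exec p
    big-Eval skip p | skip eq = retᵉ skip eq
    big-Eval (s₀ ⨾ s₁) p | seq p₀ p₁ =
      Eval-seq (big-Eval s₁) (big-Eval s₀ p₀) ∼-refl p₁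
    big-Eval (x ≔ e) p | assign eq = δᵉ assign (skip ∼-refl) eq
    big-Eval (ifte e sᵗ sᶠ) p | if-true σ⊨e p′ with ext-δ-ret p′
    ... | _ , p″ , eq = δᵉ (if-true σ⊨e) (big p″) eq
    big-Eval (ifte e sᵗ sᶠ) p | if-false σ⊭e p′ with ext-δ-ret p′
    ... | _ , p″ , eq = δᵉ (if-false σ⊭e) (big p″) eq
    big-Eval (while e sᵗ) p | while-true σ⊨e p₀ p₁ with ext-δ-ret p₀
    -- The body's resumption keeps the initial delay; inverting the second premise strips it and
    -- leaves the `seq` for the unfolded loop.
    ... | _ , p₀′ , eq₀ with ext p₁ (≈⇒∼ eq₀)
    ... | δX r∼q p₁′ eq₁ = δᵉ (while-true σ⊨e) (seq (big p₀′) r∼q p₁′) eq₁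
    big-Eval (while e sᵗ) p | while-false σ⊭e eq =
      δᵉ (while-false σ⊭e) (skip ∼-refl) eq
    big-Eval (input x) p | input eq = inpᵉ input (λ v → skip ∼-refl) eq
    big-Eval (output e) p | output eq = outᵉ output (skip ∼-refl) eq

    -- Induction on the finite nesting of `seq`; a second component starts only from a pair in `R`,
    -- where `big-Eval` applies.
    Seqs-closed : SmallStepClosed Seqs
    Seqs-closed (big p)          = big-Eval _ p
    Seqs-closed (skip p)         = retᵉ skip (∼⇒≈ p)
    Seqs-closed (seq p₀ r∼q p₁) =
      Eval-seq (big-Eval _) (Seqs-closed p₀) r∼q p₁

proposition5p1 : (L : Language) → let open Semantics L in
    (s : Stmt) (σ : State) (r : Res) → ((s , σ) ⇒ r) ⇔ ((s , σ) ⇝ r)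
proposition5p1 L s σ r = mk⇔
  (λ (R , R* , closed , p) → Seqs L closed , Seqs-closed L closed , big p)
  (λ (T , closed , p) →
    Evals L , Evals* L , Evals-closed L , ⇝-unique L closed p)
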